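{- (i) If $r\in\{3,4\}$ and $n\ge 18$, then $t_2(n,r)\ge \frac{4}{3}n-24$. (ii) If $5\le r\le n-1$ and $n>\frac{1}{6}r(r-1)$, then $t_2(n,r)\ge \frac{6}{5}n-\frac{1}{5}r(r-1)$.
   Context: All graphs are finite, simple and undirected. An $r$-colouring of a graph $G$ is a function $c:E(G)\to\{1,\dots,r\}$ (not necessarily proper). A path is rainbow if all its edges have distinct colours. For a $2$-connected graph $G$, a colouring is rainbow $2$-connected if every two vertices of $G$ are connected by two internally vertex-disjoint rainbow paths, and the rainbow $2$-connection number $rc_2(G)$ is the minimum number of colours in a rainbow $2$-connected colouring of $G$. For integers $n$ and $r\ge 1$, $t_2(n,r)$ denotes the minimum number of edges in a $2$-connected graph $G$ on $n$ vertices with $rc_2(G)\le r$. -}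

module Defs where

open import Data.Nat using (ℕ; zero; suc; _+_; _*_; _∸_; _≤_; _<_; _<ᵇ_)
open import Data.Bool using (Bool; true; false; T; _∧_; if_then_else_)
open import Data.Fin using (Fin; toℕ)
open import Data.List using (List; []; _∷_; _∷ʳ_; map; allFin)
open import Data.Nat.ListAction using (sum)
open import Data.List.Membership.Propositional using (_∈_; _∉_)
open import Data.List.Relation.Unary.Linked using (Linked)
open import Data.List.Relation.Unary.Unique.Propositional using (Unique)
open import Data.Product using (Σ; _×_; _,_; ∃; ∃-syntax)
open import Relation.Binary.PropositionalEquality using (_≡_; _≢_)
open import Relation.Nullary using (¬_)

record Graph (n : ℕ) : Set where
  field
    adj   : Fin n → Fin n → Bool
    sym   : ∀ i j → adj i j ≡ adj j i
    irrefl : ∀ i → adj i i ≡ false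

open Graph public

Adj : ∀ {n} → Graph n → Fin n → Fin n → Set
Adj G i j = T (adj G i j)

edgeCount : ∀ {n} → Graph n → ℕ
edgeCount {n} G =
  sum (map (λ i → sum (map (λ j →
    if (toℕ i <ᵇ toℕ j) ∧ adj G i j then 1 else 0) (allFin n))) (allFin n))

IsPathSeq : ∀ {n} → Graph n → List (Fin n) → Set
IsPathSeq G p = Linked (Adj G) p × Unique p

IsPath : ∀ {n} → Graph n → Fin n → Fin n → List (Fin n) → Set
IsPath G u v mid = IsPathSeq G (u ∷ (mid ∷ʳ v))

edgesOf : ∀ {n} → List (Fin n) → List (Fin n × Fin n)
edgesOf []           = []
edgesOf (x ∷ [])     = []
edgesOf (x ∷ y ∷ xs) = (x , y) ∷ edgesOf (y ∷ xs)

-- an r-colouring of the edges of G, represented as a symmetric function on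
-- vertex pairs (values on non-edges are irrelevant)
record Colouring {n} (G : Graph n) (r : ℕ) : Set where
  field
    col    : Fin n → Fin n → Fin r
    colSym : ∀ i j → col i j ≡ col j i

open Colouring public

Rainbow : ∀ {n r} {G : Graph n} → Colouring G r → Fin n → Fin n → List (Fin n) → Set
Rainbow c u v mid = Unique (map (λ e → col c (Data.Product.proj₁ e) (Data.Product.proj₂ e))
                                (edgesOf (u ∷ (mid ∷ʳ v))))

InternallyDisjoint : ∀ {n} → List (Fin n) → List (Fin n) → Set
InternallyDisjoint mid₁ mid₂ = (mid₁ ≢ mid₂) × (∀ x → x ∈ mid₁ → x ∉ mid₂)

Connected : ∀ {n} → Graph n → Set
Connected {n} G = ∀ (u v : Fin n) → u ≢ v → ∃[ mid ] IsPath G u v mid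

TwoConnected : ∀ {n} → Graph n → Set
TwoConnected {n} G =
  (3 ≤ n) × Connected G ×
  (∀ (w u v : Fin n) → u ≢ w → v ≢ w → u ≢ v →
     ∃[ mid ] (IsPath G u v mid × w ∉ mid))

RainbowTwoConnected : ∀ {n r} {G : Graph n} → Colouring G r → Set
RainbowTwoConnected {n} {r} {G} c =
  ∀ (u v : Fin n) → u ≢ v →
    ∃[ mid₁ ] ∃[ mid₂ ]
      (IsPath G u v mid₁ × IsPath G u v mid₂ ×
       Rainbow c u v mid₁ × Rainbow c u v mid₂ ×
       InternallyDisjoint mid₁ mid₂)

rc₂≤ : ∀ {n} → Graph n → ℕ → Set
rc₂≤ G r = Σ (Colouring G r) RainbowTwoConnected

-- t₂(n,r) ≥ b : every 2-connected graph on n vertices with rc₂(G) ≤ r has at least b edges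
-- (here the bound is given as a predicate on the edge count, to allow rational bounds)
t₂-lower : ℕ → ℕ → (ℕ → Set) → Set
t₂-lower n r B = ∀ (G : Graph n) → TwoConnected G → rc₂≤ G r → B (edgeCount G)

{-# OPTIONS --safe #-}
module Submission where

-- Part (ii).  A vertex of degree two sends its two rainbow paths out through both of its edges.
-- Call it long if it also has a neighbour w of degree two.  Two long vertices u, v with the same
-- two edge colours must be adjacent: otherwise a rainbow path from w through u to v repeats a
-- colour.  As three of them would form a triangle coloured with two colours, there are at most two
-- long vertices per pair of colours, so at most r(r − 1) in all.  Discharging along the edges
-- between branch vertices and the remaining vertices of degree two gives the bound.
--
-- Part (i).  If no vertex has degree two, then 2e ≥ 3n.  Otherwise take a breadth-first tree rooted
-- at a vertex v of degree two; as rainbow paths have length at most 4, the tree has depth at most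
-- 4.  A vertex at depth at least 2 is always an end of a non-tree edge, or the parent of the
-- strictly deeper end of one.  Hence each non-tree edge accounts for at most three of these n − 3
-- vertices, and 3(e − (n − 1)) ≥ n − 3.

open import Defs
open import Data.Bool using (true; false; T; _∧_; if_then_else_)
open import Data.Bool.Properties using (T?)
open import Data.Empty using (⊥)
open import Data.Fin using (Fin; zero; suc; toℕ)
import Data.Fin.Properties as Fin
open import Data.Fin.Properties using (any?; injective⇒≤)
open import Data.List using (List; []; _∷_; _∷ʳ_; map; allFin; tabulate; length; lookup)
open import Data.List.Membership.Propositional using (_∈_; _∉_)
open import Data.List.Membership.Propositional.Properties using (∈-++⁺ʳ; ∈-map⁺; ∈-lookup)
import Data.List.Membership.DecPropositional as DecMembership
open import Data.List.Properties using (map-tabulate; length-map)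
import Data.List.Relation.Unary.All as All
open import Data.List.Relation.Unary.AllPairs using ([]; _∷_)
open All using ([]; _∷_)
open import Data.List.Relation.Unary.Any using (here; there)
open import Data.List.Relation.Unary.Linked using (_∷_)
open import Data.List.Relation.Unary.Unique.Propositional using (Unique)
open import Data.Nat using (ℕ; zero; suc; _+_; _*_; _∸_; _≤_; _<_; z≤n; s≤s; s≤s⁻¹; _<ᵇ_; _<?_)
import Data.Nat as ℕ
open import Data.Nat.ListAction renaming (sum to listSum) using ()
open import Data.Nat.Properties hiding (_≟_)
open import Data.Nat.Tactic.RingSolver using (solve-∀)
open import Algebra.Properties.Semiring.Sum +-*-semiring
open import Data.Product using (_×_; _,_; ∃; ∃₂; proj₁; proj₂)
open import Data.Sum using (_⊎_; inj₁; inj₂)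
open import Function using (_∘_; id)
open import Relation.Binary.PropositionalEquality using (_≡_; _≢_; refl; trans; cong; cong₂; subst)
import Relation.Binary.PropositionalEquality as ≡
open import Relation.Nullary using (¬_; Dec; yes; no; does; contradiction)
open import Relation.Nullary.Decidable using (_×-dec_; ¬?)
open import Relation.Unary using (Decidable)

-- Indicators of decidable propositions

⟦_⟧ : {P : Set} → Dec P → ℕ
⟦ d ⟧ = if does d then 1 else 0

⟦⟧-yes : {P : Set} (d : Dec P) → P → 1 ≤ ⟦ d ⟧
⟦⟧-yes (yes _) _ = ≤-refl
⟦⟧-yes (no ¬p) p = contradiction p ¬p

⟦⟧-≤ : {P : Set} (d : Dec P) {k : ℕ} → (P → 1 ≤ k) → ⟦ d ⟧ ≤ k
⟦⟧-≤ (yes p) h = h p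
⟦⟧-≤ (no _)  _ = z≤n

scaled-⟦⟧-≤ : {P : Set} (d : Dec P) (k : ℕ) {m : ℕ} → (P → k ≤ m) → k * ⟦ d ⟧ ≤ m
scaled-⟦⟧-≤ (yes p) k h = ≤-trans (≤-reflexive (*-identityʳ k)) (h p)
scaled-⟦⟧-≤ (no _)  k h = ≤-trans (≤-reflexive (*-zeroʳ k)) z≤n

-- Finite sums

listSum-allFin : ∀ {n} (f : Fin n → ℕ) → listSum (map f (allFin n)) ≡ sum f
listSum-allFin f = trans (cong listSum (map-tabulate id f)) (go f)
  where
  go : ∀ {n} (f : Fin n → ℕ) → listSum (tabulate f) ≡ sum f
  go {zero}  f = refl
  go {suc n} f = cong (f zero +_) (go (f ∘ suc))

∑-mono : ∀ {n} {f g : Fin n → ℕ} → (∀ i → f i ≤ g i) → sum f ≤ sum g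
∑-mono {zero}  h = z≤n
∑-mono {suc n} h = +-mono-≤ (h zero) (∑-mono (h ∘ suc))

∑-const : ∀ n k → ∑[ i < n ] k ≡ n * k
∑-const zero    k = refl
∑-const (suc n) k = cong (k +_) (∑-const n k)

∑-scale : ∀ {n} k (f : Fin n → ℕ) → ∑[ i < n ] (k * f i) ≡ k * sum f
∑-scale k f = ≡.sym (*-distribˡ-sum k f)

term≤∑ : ∀ {n} (f : Fin n → ℕ) i → f i ≤ sum f
term≤∑ f zero    = m≤m+n _ _
term≤∑ f (suc i) = ≤-trans (term≤∑ (f ∘ suc) i) (m≤n+m _ _)

two-terms≤∑ : ∀ {n} (f : Fin n → ℕ) {i j} → i ≢ j → f i + f j ≤ sum f
two-terms≤∑ f {zero}  {zero}  i≢j = contradiction refl i≢j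
two-terms≤∑ f {zero}  {suc j} _   = +-monoʳ-≤ (f zero) (term≤∑ (f ∘ suc) j)
two-terms≤∑ f {suc i} {zero}  _   =
  ≤-trans (≤-reflexive (+-comm (f (suc i)) _)) (+-monoʳ-≤ (f zero) (term≤∑ (f ∘ suc) i))
two-terms≤∑ f {suc i} {suc j} i≢j =
  ≤-trans (two-terms≤∑ (f ∘ suc) (i≢j ∘ cong suc)) (m≤n+m _ _)

-- The two entries lie in different rows, so an unordered pair contributes twice to a sum over
-- ordered pairs. Colour pairs and non-tree edges are both counted in this way.
∑∑-swapped-pair : ∀ {n} (f : Fin n → Fin n → ℕ) {i j} → i ≢ j → 1 ≤ f i j → 1 ≤ f j i →
                  2 ≤ ∑[ a < n ] ∑[ b < n ] f a b
∑∑-swapped-pair f {i} {j} i≢j fij fji =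
  ≤-trans (+-mono-≤ (≤-trans fij (term≤∑ (f i) j)) (≤-trans fji (term≤∑ (f j) i)))
          (two-terms≤∑ (λ a → sum (f a)) i≢j)

∑-δ : ∀ {n} (i : Fin n) → ∑[ j < n ] ⟦ j Fin.≟ i ⟧ ≡ 1
∑-δ {suc n} zero    = cong suc (sum-replicate-zero n)
∑-δ {suc n} (suc i) = ∑-δ i

∑-two-δ : ∀ {n} (a b : Fin n) → ∑[ x < n ] (⟦ x Fin.≟ a ⟧ + ⟦ x Fin.≟ b ⟧) ≡ 2
∑-two-δ a b = trans (∑-distrib-+ (λ x → ⟦ x Fin.≟ a ⟧) (λ x → ⟦ x Fin.≟ b ⟧)) (cong₂ _+_ (∑-δ a) (∑-δ b))

∑-three-δ : ∀ {n} (a b c : Fin n) →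
            ∑[ x < n ] (⟦ x Fin.≟ a ⟧ + ⟦ x Fin.≟ b ⟧ + ⟦ x Fin.≟ c ⟧) ≡ 3
∑-three-δ a b c = trans (∑-distrib-+ (λ x → ⟦ x Fin.≟ a ⟧ + ⟦ x Fin.≟ b ⟧) (λ x → ⟦ x Fin.≟ c ⟧)) (cong₂ _+_ (∑-two-δ a b) (∑-δ c))

three-δ-cover : ∀ {n} {x : Fin n} a b c → x ≡ a ⊎ x ≡ b ⊎ x ≡ c →
                1 ≤ ⟦ x Fin.≟ a ⟧ + ⟦ x Fin.≟ b ⟧ + ⟦ x Fin.≟ c ⟧
three-δ-cover {x = x} a b c h with x Fin.≟ a | x Fin.≟ b | x Fin.≟ c
... | yes _  | _      | _      = s≤s z≤n
... | no _   | yes _  | _      = s≤s z≤n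
... | no _   | no _   | yes _  = s≤s z≤n
... | no x≢a | no x≢b | no x≢c with h
...   | inj₁ e        = contradiction e x≢a
...   | inj₂ (inj₁ e) = contradiction e x≢b
...   | inj₂ (inj₂ e) = contradiction e x≢c

module _ {n} {P : Fin n → Set} (P? : Decidable P) where

  two≤count : ∀ {a b} → a ≢ b → P a → P b → 2 ≤ ∑[ x < n ] ⟦ P? x ⟧
  two≤count {a} {b} a≢b pa pb =
    ≤-trans (+-mono-≤ (⟦⟧-yes (P? a) pa) (⟦⟧-yes (P? b) pb)) (two-terms≤∑ _ a≢b)

  three≤count : ∀ {a b c} → a ≢ b → a ≢ c → b ≢ c → P a → P b → P c → 3 ≤ ∑[ x < n ] ⟦ P? x ⟧
  three≤count {a} {b} {c} a≢b a≢c b≢c pa pb pc =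
    ≤-trans (≤-reflexive (≡.sym (∑-three-δ a b c))) (∑-mono pointwise)
    where
    pointwise : ∀ x → ⟦ x Fin.≟ a ⟧ + ⟦ x Fin.≟ b ⟧ + ⟦ x Fin.≟ c ⟧ ≤ ⟦ P? x ⟧
    pointwise x with x Fin.≟ a | x Fin.≟ b | x Fin.≟ c
    ... | yes refl | yes refl | _        = contradiction refl a≢b
    ... | yes refl | no _     | yes refl = contradiction refl a≢c
    ... | no _     | yes refl | yes refl = contradiction refl b≢c
    ... | yes refl | no _     | no _     = ⟦⟧-yes (P? x) pa
    ... | no _     | yes refl | no _     = ⟦⟧-yes (P? x) pb
    ... | no _     | no _     | yes refl = ⟦⟧-yes (P? x) pc
    ... | no _     | no _     | no _     = z≤n

  count≤two : (∀ {a b x} → P a → P b → P x → a ≢ b → x ≢ a → x ≢ b → ⊥) →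
              ∑[ x < n ] ⟦ P? x ⟧ ≤ 2
  count≤two no-three with any? P?
  ... | no ¬p = ≤-trans (∑-mono λ x → ⟦⟧-≤ (P? x) {0} λ p → contradiction (x , p) ¬p)
                        (≤-trans (≤-reflexive (sum-replicate-zero n)) z≤n)
  ... | yes (a , pa) with any? (λ b → P? b ×-dec ¬? (a Fin.≟ b))
  ...   | no ¬b = ≤-trans (∑-mono pointwise) (≤-trans (≤-reflexive (∑-δ a)) (s≤s z≤n))
    where
    pointwise : ∀ x → ⟦ P? x ⟧ ≤ ⟦ x Fin.≟ a ⟧
    pointwise x = ⟦⟧-≤ (P? x) λ px → ⟦⟧-yes (x Fin.≟ a) (x≡a px)
      where
      x≡a : P x → x ≡ a
      x≡a px with x Fin.≟ a
      ... | yes e = e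
      ... | no x≢a = contradiction (x , px , x≢a ∘ ≡.sym) ¬b
  ...   | yes (b , pb , a≢b) = ≤-trans (∑-mono pointwise) (≤-reflexive (∑-two-δ a b))
    where
    pointwise : ∀ x → ⟦ P? x ⟧ ≤ ⟦ x Fin.≟ a ⟧ + ⟦ x Fin.≟ b ⟧
    pointwise x with P? x | x Fin.≟ a | x Fin.≟ b
    ... | no _   | _      | _       = z≤n
    ... | yes _  | yes _  | _       = s≤s z≤n
    ... | yes _  | no _   | yes _   = ≤-refl
    ... | yes px | no x≢a | no x≢b  = contradiction x≢b (no-three pa pb px a≢b x≢a)

-- Duplicate-free lists and paths as lists

Unique⇒lookup-injective : ∀ {A : Set} {xs : List A} → Unique xs →
                          ∀ {i j} → lookup xs i ≡ lookup xs j → i ≡ j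
Unique⇒lookup-injective (_ ∷ _)   {zero}  {zero}  _ = refl
Unique⇒lookup-injective {xs = _ ∷ xs} (x∉ ∷ _)  {zero}  {suc j} e =
  contradiction e (All.lookup x∉ (∈-lookup j))
Unique⇒lookup-injective {xs = _ ∷ xs} (x∉ ∷ _)  {suc i} {zero}  e =
  contradiction (≡.sym e) (All.lookup x∉ (∈-lookup i))
Unique⇒lookup-injective (_ ∷ u)   {suc i} {suc j} e = cong suc (Unique⇒lookup-injective u e)

-- Pigeonhole on positions. Applied to the colours along a rainbow path, it bounds the number of
-- edges by the number of colours.
Unique⇒length≤ : ∀ {r} {xs : List (Fin r)} → Unique xs → length xs ≤ r
Unique⇒length≤ u = injective⇒≤ (Unique⇒lookup-injective u)

last∈∷ʳ : ∀ {A : Set} (xs : List A) {v} → v ∈ xs ∷ʳ v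
last∈∷ʳ xs = ∈-++⁺ʳ xs (here refl)

-- For a path with interior `xs` and end `v`, this is its second vertex, also when the path is a
-- single edge.
headOr : ∀ {A : Set} → A → List A → A
headOr v []      = v
headOr v (x ∷ _) = x

length-edgesOf : ∀ {n} (u v : Fin n) m → length (edgesOf (u ∷ (m ∷ʳ v))) ≡ suc (length m)
length-edgesOf u v []      = refl
length-edgesOf u v (x ∷ m) = cong suc (length-edgesOf x v m)

three-in-two : ∀ {A : Set} {p q x y z : A} → x ≡ p ⊎ x ≡ q → y ≡ p ⊎ y ≡ q → z ≡ p ⊎ z ≡ q →
               x ≢ y → x ≢ z → y ≢ z → ⊥
three-in-two (inj₁ refl) (inj₁ refl) _           x≢y _   _   = x≢y refl
three-in-two (inj₁ refl) (inj₂ refl) (inj₁ refl) _   x≢z _   = x≢z refl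
three-in-two (inj₁ refl) (inj₂ refl) (inj₂ refl) _   _   y≢z = y≢z refl
three-in-two (inj₂ refl) (inj₂ refl) _           x≢y _   _   = x≢y refl
three-in-two (inj₂ refl) (inj₁ refl) (inj₂ refl) _   x≢z _   = x≢z refl
three-in-two (inj₂ refl) (inj₁ refl) (inj₁ refl) _   _   y≢z = y≢z refl

-- Degrees

module _ {n} (G : Graph n) where

  adj? : ∀ i j → Dec (Adj G i j)
  adj? i j = T? (adj G i j)

  Adj-sym : ∀ {i j} → Adj G i j → Adj G j i
  Adj-sym {i} {j} = subst T (Graph.sym G i j)

  Adj⇒≢ : ∀ {i j} → Adj G i j → i ≢ j
  Adj⇒≢ {i} a refl = subst T (irrefl G i) a

  deg : Fin n → ℕ
  deg x = ∑[ y < n ] ⟦ adj? x y ⟧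

  degree-two-nbr : ∀ {x a b c} → deg x ≡ 2 → Adj G x a → Adj G x b → a ≢ b → Adj G x c →
                   c ≡ a ⊎ c ≡ b
  degree-two-nbr {x} {a} {b} {c} d xa xb a≢b xc with c Fin.≟ a | c Fin.≟ b
  ... | yes e  | _      = inj₁ e
  ... | no _   | yes e  = inj₂ e
  ... | no c≢a | no c≢b =
    contradiction (three≤count (adj? x) a≢b (c≢a ∘ ≡.sym) (c≢b ∘ ≡.sym) xa xb xc)
                  λ h → contradiction (≤-trans h (≤-reflexive d)) λ { (s≤s (s≤s ())) }

  handshake : ∑[ x < n ] deg x ≡ 2 * edgeCount G
  handshake = begin
    ∑[ i < n ] ∑[ j < n ] ⟦ adj? i j ⟧                          ≡⟨ sum-cong-≗ (λ i → sum-cong-≗ (split i)) ⟩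
    ∑[ i < n ] ∑[ j < n ] (f i j + f j i)                       ≡⟨ sum-cong-≗ (λ i → ∑-distrib-+ (f i) (λ j → f j i)) ⟩
    ∑[ i < n ] (sum (f i) + ∑[ j < n ] f j i)                   ≡⟨ ∑-distrib-+ (λ i → sum (f i)) _ ⟩
    ∑[ i < n ] sum (f i) + ∑[ i < n ] ∑[ j < n ] f j i          ≡⟨ cong (S +_) (∑-comm (λ i j → f j i)) ⟩
    S + S                                                       ≡⟨ cong (S +_) (+-identityʳ S) ⟨
    2 * S                                                       ≡⟨ cong (2 *_) S≡edgeCount ⟩
    2 * edgeCount G                                             ∎
    where
    open ≡.≡-Reasoning
    f : Fin n → Fin n → ℕ
    f i j = if (toℕ i <ᵇ toℕ j) ∧ adj G i j then 1 else 0
    S = ∑[ i < n ] sum (f i)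
    S≡edgeCount : S ≡ edgeCount G
    S≡edgeCount = ≡.sym (trans (listSum-allFin (λ i → listSum (map (f i) (allFin n)))) (sum-cong-≗ λ i → listSum-allFin (f i)))
    -- Off the diagonal exactly one of the two orders holds, so an edge is counted in exactly one of
    -- `f i j` and `f j i`; on the diagonal irreflexivity makes everything vanish.
    split : ∀ i j → ⟦ adj? i j ⟧ ≡ f i j + f j i
    split i j with toℕ i <ᵇ toℕ j in i<j | toℕ j <ᵇ toℕ i in j<i
    ... | true  | false = ≡.sym (+-identityʳ _)
    ... | false | true  = cong (if_then 1 else 0) (Graph.sym G i j)
    ... | true  | true  = contradiction (<ᵇ⇒< (toℕ j) (toℕ i) (subst T (≡.sym j<i) _))
                                        (<-asym (<ᵇ⇒< (toℕ i) (toℕ j) (subst T (≡.sym i<j) _)))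
    ... | false | false with adj G i j in e
    ...   | false = refl
    ...   | true  = contradiction i≡j (Adj⇒≢ (subst T (≡.sym e) _))
      where
      i≡j : i ≡ j
      i≡j = Fin.toℕ-injective (≤-antisym
        (≮⇒≥ λ lt → subst T j<i (<⇒<ᵇ lt))
        (≮⇒≥ λ lt → subst T i<j (<⇒<ᵇ lt)))

  min-degree-three⇒3n≤2e : (∀ x → 3 ≤ deg x) → n * 3 ≤ 2 * edgeCount G
  min-degree-three⇒3n≤2e h =
    ≤-trans (≤-reflexive (≡.sym (∑-const n 3))) (≤-trans (∑-mono h) (≤-reflexive handshake))

  -- Paths

  path-headOr : ∀ {u v} m → IsPath G u v m → Adj G u (headOr v m)
  path-headOr []      (a ∷ _ , _) = a
  path-headOr (_ ∷ _) (a ∷ _ , _) = a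

  path-tail : ∀ {u v x} m → IsPath G u v (x ∷ m) → IsPath G x v m
  path-tail m (_ ∷ l , _ ∷ u) = l , u

  path-∉ : ∀ {u v} m {x} → IsPath G u v m → x ∈ m ∷ʳ v → x ≢ u
  path-∉ m (_ , u∉ ∷ _) x∈ refl = All.lookup u∉ x∈ refl

  headOr∈ : ∀ {v : Fin n} m → headOr v m ∈ m ∷ʳ v
  headOr∈ []      = here refl
  headOr∈ (x ∷ m) = here refl

  -- A common second vertex would be a shared inner vertex, or both interiors would be empty and
  -- hence equal, or one path would be the edge to `v` and the other would visit `v` twice.
  disjoint-headOr : ∀ {u v m₁ m₂} → IsPath G u v m₁ → IsPath G u v m₂ →
                    InternallyDisjoint m₁ m₂ → headOr v m₁ ≢ headOr v m₂
  disjoint-headOr {m₁ = []}     {[]}     _ _ (m≢ , _) _ = m≢ refl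
  disjoint-headOr {m₁ = []}     {x ∷ m₂} _ p₂ _ refl = path-∉ m₂ (path-tail m₂ p₂) (last∈∷ʳ m₂) refl
  disjoint-headOr {m₁ = x ∷ m₁} {[]}     p₁ _ _ refl = path-∉ m₁ (path-tail m₁ p₁) (last∈∷ʳ m₁) refl
  disjoint-headOr {m₁ = x ∷ m₁} {y ∷ m₂} _ _ (_ , d) refl = d x (here refl) (here refl)

  last-edge : ∀ {u v} m → IsPath G u v m → ∃ λ t → Adj G t v × (t , v) ∈ edgesOf (u ∷ (m ∷ʳ v))
  last-edge []      p = _ , path-headOr [] p , here refl
  last-edge (x ∷ m) p with last-edge m (path-tail m p)
  ... | t , tv , t∈ = t , tv , there t∈

-- Local consequences of rainbow 2-connection

module RainbowTwoConnectedGraph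
  {n r : ℕ} (G : Graph n) (c : Colouring G r) (rtc : RainbowTwoConnected c) where

  two-neighbours : ∀ {u v} → u ≢ v → ∃₂ λ a b → a ≢ b × Adj G u a × Adj G u b
  two-neighbours {u} {v} u≢v with rtc u v u≢v
  ... | m₁ , m₂ , p₁ , p₂ , _ , _ , d =
    headOr v m₁ , headOr v m₂ , disjoint-headOr G p₁ p₂ d , path-headOr G m₁ p₁ , path-headOr G m₂ p₂

  -- The two disjoint paths leave `u` through different neighbours, so at degree two they use both,
  -- and one of them starts with `h`. As `h ≢ v`, that path has `h` as an inner vertex.
  rainbow-path-via : ∀ {u v h} → u ≢ v → deg G u ≡ 2 → Adj G u h → h ≢ v →
                     ∃ λ m → IsPath G u v (h ∷ m) × Rainbow c u v (h ∷ m)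
  rainbow-path-via {u} {v} {h} u≢v du uh h≢v with rtc u v u≢v
  ... | m₁ , m₂ , p₁ , p₂ , r₁ , r₂ , d =
    pick (degree-two-nbr G du (path-headOr G m₁ p₁) (path-headOr G m₂ p₂) (disjoint-headOr G p₁ p₂ d) uh)
    where
    starts : ∀ {m} → IsPath G u v m → Rainbow c u v m → h ≡ headOr v m →
             ∃ λ m → IsPath G u v (h ∷ m) × Rainbow c u v (h ∷ m)
    starts {[]}    _ _ e    = contradiction e h≢v
    starts {x ∷ m} p r refl = m , p , r
    pick : h ≡ headOr v m₁ ⊎ h ≡ headOr v m₂ → _
    pick (inj₁ e) = starts p₁ r₁ e
    pick (inj₂ e) = starts p₂ r₂ e

  rainbow-first-two : ∀ {u v h m} → Rainbow c u v (h ∷ m) → col c u h ≢ col c h (headOr v m)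
  rainbow-first-two {m = []}    ((ne ∷ _) ∷ _) = ne
  rainbow-first-two {m = _ ∷ _} ((ne ∷ _) ∷ _) = ne

  -- Vertices of degree two with a neighbour of degree two

  Long : Fin n → Set
  Long u = deg G u ≡ 2 × ∃ λ w → Adj G u w × deg G w ≡ 2

  Long? : Decidable Long
  Long? u = (deg G u ℕ.≟ 2) ×-dec any? λ w → adj? G u w ×-dec (deg G w ℕ.≟ 2)

  -- Since `w` has degree two, some rainbow path from `w` to `z` starts through `u`. Since `u` has
  -- degree two and `w` is already visited, it continues to `z`; its two edges are the ones
  -- compared.
  link-colours-distinct : ∀ {u w z} → deg G u ≡ 2 → deg G w ≡ 2 → Adj G u w → Adj G u z → w ≢ z →
                          col c u w ≢ col c u z
  link-colours-distinct {u} {w} {z} du dw uw uz w≢z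
    with rainbow-path-via w≢z dw (Adj-sym G uw) (Adj⇒≢ G uz)
  ... | m , p , rb = subst (λ y → col c u w ≢ col c u y) second≡z
                       (rainbow-first-two rb ∘ trans (colSym c w u))
    where
    second≡z : headOr z m ≡ z
    second≡z with degree-two-nbr G du uw uz w≢z (path-headOr G m (path-tail G m p))
    ... | inj₁ e = contradiction e (path-∉ G (u ∷ m) p (there (headOr∈ G m)))
    ... | inj₂ e = e

  long-colours-distinct : ∀ {u a b} → Long u → Adj G u a → Adj G u b → a ≢ b → col c u a ≢ col c u b
  long-colours-distinct (du , w , uw , dw) ua ub a≢b with degree-two-nbr G du ua ub a≢b uw
  ... | inj₁ refl = link-colours-distinct du dw ua ub a≢b
  ... | inj₂ refl = link-colours-distinct du dw ub ua (a≢b ∘ ≡.sym) ∘ ≡.sym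

  HasColour : Fin n → Fin r → Set
  HasColour u p = ∃ λ y → Adj G u y × col c u y ≡ p

  HasColour? : ∀ u p → Dec (HasColour u p)
  HasColour? u p = any? λ y → adj? G u y ×-dec (col c u y Fin.≟ p)

  -- The colour pair is ordered, so a vertex appears under both orders. The condition `p ≢ q`
  -- empties the diagonal, which leaves r(r - 1) pairs.
  Coloured : Fin r → Fin r → Fin n → Set
  Coloured p q u = Long u × p ≢ q × HasColour u p × HasColour u q

  Coloured? : ∀ p q → Decidable (Coloured p q)
  Coloured? p q u = Long? u ×-dec ¬? (p Fin.≟ q) ×-dec HasColour? u p ×-dec HasColour? u q

  nbr-colour : ∀ {p q u y} → Coloured p q u → Adj G u y → col c u y ≡ p ⊎ col c u y ≡ q
  nbr-colour ((du , _) , p≢q , (a , ua , refl) , (b , ub , refl)) uy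
    with degree-two-nbr G du ua ub (p≢q ∘ cong (col c _)) uy
  ... | inj₁ refl = inj₁ refl
  ... | inj₂ refl = inj₂ refl

  -- Otherwise a rainbow path from the degree-two neighbour w of u through u to v would begin with
  -- both colours of u and end with one of them.
  same-colours⇒Adj : ∀ {p q u v} → Coloured p q u → Coloured p q v → u ≢ v → Adj G u v
  same-colours⇒Adj {p} {q} {u} {v} Cu@((_ , w , uw , dw) , _) Cv u≢v with adj? G u v
  ... | yes uv = uv
  ... | no ¬uv with rainbow-path-via {w} {v} w≢v dw (Adj-sym G uw) u≢v
    where
    w≢v : w ≢ v
    w≢v refl = ¬uv uw
  ...   | [] , path , _ = path-headOr G [] (path-tail G [] path)
  ...   | y ∷ m , path , (e₁∉ ∷ e₂∉ ∷ _)
    with last-edge G m (path-tail G m (path-tail G (y ∷ m) path))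
  ...     | t , tv , t∈ = contradiction
    (three-in-two
      (subst Among (colSym c u w) (nbr-colour Cu uw))
      (nbr-colour Cu (path-headOr G (y ∷ m) (path-tail G (y ∷ m) path)))
      (subst Among (colSym c v t) (nbr-colour Cv (Adj-sym G tv)))
      (All.lookup e₁∉ (here refl))
      (All.lookup e₁∉ (there (∈-map⁺ _ t∈)))
      (All.lookup e₂∉ (∈-map⁺ _ t∈)))
    λ ()
    where
    Among : Fin r → Set
    Among x = x ≡ p ⊎ x ≡ q

  -- A third vertex would give a triangle whose three edges have distinct colours among p and q.
  count-Coloured≤two : ∀ p q → ∑[ u < n ] ⟦ Coloured? p q u ⟧ ≤ 2
  count-Coloured≤two p q = count≤two (Coloured? p q) no-three
    where
    no-three : ∀ {a b x} → Coloured p q a → Coloured p q b → Coloured p q x →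
               a ≢ b → x ≢ a → x ≢ b → ⊥
    no-three {a} {b} {x} Ca Cb Cx a≢b x≢a x≢b =
      three-in-two (nbr-colour Ca ab) (nbr-colour Ca ax) (nbr-colour Cb bx)
        (long-colours-distinct (proj₁ Ca) ab ax (x≢b ∘ ≡.sym))
        (λ e → long-colours-distinct (proj₁ Cb) (Adj-sym G ab) bx (x≢a ∘ ≡.sym)
                 (trans (colSym c b a) e))
        (λ e → long-colours-distinct (proj₁ Cx) (Adj-sym G ax) (Adj-sym G bx) a≢b
                 (trans (colSym c x a) (trans e (colSym c b x))))
      where
      ab = same-colours⇒Adj Ca Cb a≢b
      ax = same-colours⇒Adj Ca Cx (x≢a ∘ ≡.sym)
      bx = same-colours⇒Adj Cb Cx (x≢b ∘ ≡.sym)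

  -- Counting long vertices by colour pairs

  longCount : ℕ
  longCount = ∑[ u < n ] ⟦ Long? u ⟧

  module _ (other : ∀ (u : Fin n) → ∃ (u ≢_)) where

    two-colour-pairs : ∀ u → 2 * ⟦ Long? u ⟧ ≤ ∑[ p < r ] ∑[ q < r ] ⟦ Coloured? p q u ⟧
    two-colour-pairs u = scaled-⟦⟧-≤ (Long? u) 2 pairs
      where
      pairs : Long u → 2 ≤ ∑[ p < r ] ∑[ q < r ] ⟦ Coloured? p q u ⟧
      pairs l with two-neighbours (proj₂ (other u))
      ... | a , b , a≢b , ua , ub = ∑∑-swapped-pair (λ p q → ⟦ Coloured? p q u ⟧) p≢q
        (⟦⟧-yes (Coloured? _ _ u) (l , p≢q , (a , ua , refl) , (b , ub , refl)))
        (⟦⟧-yes (Coloured? _ _ u) (l , p≢q ∘ ≡.sym , (b , ub , refl) , (a , ua , refl)))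
        where
        p≢q : col c u a ≢ col c u b
        p≢q = long-colours-distinct l ua ub a≢b

    -- Double counting: each long vertex appears under at least two ordered colour pairs, and each
    -- of the r(r - 1) off-diagonal pairs holds at most two vertices.
    longCount≤ : longCount ≤ r * (r ∸ 1)
    longCount≤ = *-cancelˡ-≤ 2 (begin
      2 * longCount                                              ≡⟨ ∑-scale 2 (λ u → ⟦ Long? u ⟧) ⟨
      ∑[ u < n ] (2 * ⟦ Long? u ⟧)                               ≤⟨ ∑-mono two-colour-pairs ⟩
      ∑[ u < n ] ∑[ p < r ] ∑[ q < r ] ⟦ Coloured? p q u ⟧       ≡⟨ ∑-comm (λ u p → ∑[ q < r ] ⟦ Coloured? p q u ⟧) ⟩
      ∑[ p < r ] ∑[ u < n ] ∑[ q < r ] ⟦ Coloured? p q u ⟧       ≡⟨ sum-cong-≗ (λ p → ∑-comm (λ u q → ⟦ Coloured? p q u ⟧)) ⟩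
      ∑[ p < r ] ∑[ q < r ] ∑[ u < n ] ⟦ Coloured? p q u ⟧       ≤⟨ ∑-mono per-colour ⟩
      ∑[ p < r ] (2 * (r ∸ 1))                                   ≡⟨ ∑-const r _ ⟩
      r * (2 * (r ∸ 1))                                          ≡⟨ *-assoc r 2 (r ∸ 1) ⟨
      r * 2 * (r ∸ 1)                                            ≡⟨ cong (_* (r ∸ 1)) (*-comm r 2) ⟩
      2 * r * (r ∸ 1)                                            ≡⟨ *-assoc 2 r (r ∸ 1) ⟩
      2 * (r * (r ∸ 1))                                          ∎)
      where
      open ≤-Reasoning
      -- The diagonal pair holds no vertex; adding 2 there keeps the bound 2 uniform in `q`, and
      -- subtracting this 2 from the row sum 2r gives 2(r - 1).
      per-pair : ∀ p q → (∑[ u < n ] ⟦ Coloured? p q u ⟧) + 2 * ⟦ q Fin.≟ p ⟧ ≤ 2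
      per-pair p q with q Fin.≟ p
      ... | no _     = ≤-trans (≤-reflexive (+-identityʳ _)) (count-Coloured≤two p q)
      ... | yes refl = +-monoˡ-≤ 2 (≤-trans
        (∑-mono λ u → ⟦⟧-≤ (Coloured? p p u) {0} λ C → contradiction refl (proj₁ (proj₂ C)))
        (≤-reflexive (sum-replicate-zero n)))
      per-colour : ∀ p → ∑[ q < r ] ∑[ u < n ] ⟦ Coloured? p q u ⟧ ≤ 2 * (r ∸ 1)
      per-colour p = begin
        C                                          ≡⟨ m+n∸n≡m C 2 ⟨
        C + 2 ∸ 2                                  ≡⟨ cong (λ k → C + 2 * k ∸ 2) (∑-δ p) ⟨
        C + 2 * (∑[ q < r ] ⟦ q Fin.≟ p ⟧) ∸ 2     ≡⟨ cong (λ k → C + k ∸ 2) (∑-scale 2 (λ q → ⟦ q Fin.≟ p ⟧)) ⟨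
        C + (∑[ q < r ] (2 * ⟦ q Fin.≟ p ⟧)) ∸ 2   ≡⟨ cong (_∸ 2) (∑-distrib-+ (λ q → ∑[ u < n ] ⟦ Coloured? p q u ⟧) (λ q → 2 * ⟦ q Fin.≟ p ⟧)) ⟨
        (∑[ q < r ] ((∑[ u < n ] ⟦ Coloured? p q u ⟧) + 2 * ⟦ q Fin.≟ p ⟧)) ∸ 2
                                                   ≤⟨ ∸-monoˡ-≤ 2 (∑-mono (per-pair p)) ⟩
        (∑[ q < r ] 2) ∸ 2                         ≡⟨ cong (_∸ 2) (trans (∑-const r 2) (*-comm r 2)) ⟩
        2 * r ∸ 2                                  ≡⟨ *-distribˡ-∸ 2 r 1 ⟨
        2 * (r ∸ 1)                                ∎
        where C = ∑[ q < r ] ∑[ u < n ] ⟦ Coloured? p q u ⟧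

    -- Minimum degree and discharging

    2≤deg : ∀ u → 2 ≤ deg G u
    2≤deg u with two-neighbours (proj₂ (other u))
    ... | a , b , a≢b , ua , ub = two≤count (adj? G u) a≢b ua ub

    -- Charges are scaled by 12 per vertex: a vertex of degree d ≥ 3 can pay 1 along each of its
    -- edges since 5d − 12 ≥ d, and a short vertex of degree two needs 12 − 10 = 2.
    ReceivesFrom : Fin n → Fin n → Set
    ReceivesFrom x y = Adj G x y × deg G x ≡ 2 × ¬ Long x

    ReceivesFrom? : ∀ x y → Dec (ReceivesFrom x y)
    ReceivesFrom? x y = adj? G x y ×-dec (deg G x ℕ.≟ 2) ×-dec ¬? (Long? x)

    received paid : Fin n → ℕ
    received x = ∑[ y < n ] ⟦ ReceivesFrom? x y ⟧
    paid y     = ∑[ x < n ] ⟦ ReceivesFrom? x y ⟧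

    paid≤deg : ∀ y → paid y ≤ deg G y
    paid≤deg y = ∑-mono λ x → ⟦⟧-≤ (ReceivesFrom? x y) λ (xy , _) → ⟦⟧-yes (adj? G y x) (Adj-sym G xy)

    -- A neighbour of degree two would be long because of `y`, and long vertices receive nothing.
    degree-two⇒paid≤0 : ∀ {y} → deg G y ≡ 2 → paid y ≤ 0
    degree-two⇒paid≤0 {y} dy = ≤-trans
      (∑-mono λ x → ⟦⟧-≤ (ReceivesFrom? x y) {0} λ (xy , dx , ¬l) → contradiction (dx , y , xy , dy) ¬l)
      (≤-reflexive (sum-replicate-zero n))

    short⇒2≤received : ∀ {x} → deg G x ≡ 2 → ¬ Long x → 2 ≤ received x
    short⇒2≤received {x} dx ¬l = ≤-trans (≤-reflexive (≡.sym dx))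
      (∑-mono λ y → ⟦⟧-≤ (adj? G x y) λ xy → ⟦⟧-yes (ReceivesFrom? x y) (xy , dx , ¬l))

    -- The weight 5 on degrees becomes 10e after summation. A long vertex is short of 2 as well, but
    -- its deficit is met by the error term instead of by its neighbours.
    vertex-balance : ∀ x → 12 + paid x ≤ 5 * deg G x + 2 * ⟦ Long? x ⟧ + received x
    vertex-balance x with deg G x ℕ.≟ 2
    ... | yes dx = begin
      12 + paid x                                        ≤⟨ +-monoʳ-≤ 12 (degree-two⇒paid≤0 dx) ⟩
      10 + 2                                             ≤⟨ +-monoʳ-≤ 10 gain ⟩
      10 + (2 * ⟦ Long? x ⟧ + received x)                ≡⟨ +-assoc 10 (2 * ⟦ Long? x ⟧) (received x) ⟨
      10 + 2 * ⟦ Long? x ⟧ + received x                  ≡⟨ cong (λ k → 5 * k + 2 * ⟦ Long? x ⟧ + received x) dx ⟨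
      5 * deg G x + 2 * ⟦ Long? x ⟧ + received x         ∎
      where
      open ≤-Reasoning
      gain : 2 ≤ 2 * ⟦ Long? x ⟧ + received x
      gain = by (Long? x)
        where
        by : (l : Dec (Long x)) → 2 ≤ 2 * ⟦ l ⟧ + received x
        by (yes _) = m≤m+n 2 _
        by (no ¬l) = short⇒2≤received dx ¬l
    ... | no dx≢2 = begin
      12 + paid x                                        ≤⟨ +-mono-≤ (*-monoʳ-≤ 4 (≤∧≢⇒< (2≤deg x) (dx≢2 ∘ ≡.sym))) (paid≤deg x) ⟩
      4 * deg G x + deg G x                              ≡⟨ +-comm (4 * deg G x) (deg G x) ⟩
      5 * deg G x                                        ≤⟨ m≤m+n _ _ ⟩
      5 * deg G x + 2 * ⟦ Long? x ⟧                      ≤⟨ m≤m+n _ _ ⟩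
      5 * deg G x + 2 * ⟦ Long? x ⟧ + received x         ∎
      where open ≤-Reasoning

    -- The totals paid and received are one double sum read in two orders, so they cancel once the
    -- vertex balances are added up.
    12n≤10e+2longCount : n * 12 ≤ 10 * edgeCount G + 2 * longCount
    12n≤10e+2longCount = +-cancelʳ-≤ (sum received) _ _ (begin
      n * 12 + sum received                                      ≡⟨ cong₂ _+_ (∑-const n 12) (∑-comm (λ y x → ⟦ ReceivesFrom? x y ⟧)) ⟨
      (∑[ x < n ] 12) + sum paid                                 ≡⟨ ∑-distrib-+ (λ _ → 12) paid ⟨
      ∑[ x < n ] (12 + paid x)                                   ≤⟨ ∑-mono vertex-balance ⟩
      ∑[ x < n ] (5 * deg G x + 2 * ⟦ Long? x ⟧ + received x)    ≡⟨ ∑-distrib-+ (λ x → 5 * deg G x + 2 * ⟦ Long? x ⟧) received ⟩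
      (∑[ x < n ] (5 * deg G x + 2 * ⟦ Long? x ⟧)) + sum received
                                                                 ≡⟨ cong (_+ sum received) totals ⟩
      10 * edgeCount G + 2 * longCount + sum received            ∎)
      where
      open ≤-Reasoning
      totals : ∑[ x < n ] (5 * deg G x + 2 * ⟦ Long? x ⟧) ≡ 10 * edgeCount G + 2 * longCount
      totals = trans (∑-distrib-+ (λ x → 5 * deg G x) (λ x → 2 * ⟦ Long? x ⟧))
        (cong₂ _+_
          (trans (∑-scale 5 (deg G)) (trans (cong (5 *_) (handshake G)) (≡.sym (*-assoc 5 2 (edgeCount G)))))
          (∑-scale 2 (λ x → ⟦ Long? x ⟧)))

    6n≤5e+r[r-1] : 6 * n ≤ 5 * edgeCount G + r * (r ∸ 1)
    6n≤5e+r[r-1] = *-cancelˡ-≤ 2 (begin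
      2 * (6 * n)                               ≡⟨ *-assoc 2 6 n ⟨
      12 * n                                    ≡⟨ *-comm 12 n ⟩
      n * 12                                    ≤⟨ 12n≤10e+2longCount ⟩
      10 * edgeCount G + 2 * longCount          ≤⟨ +-monoʳ-≤ (10 * edgeCount G) (*-monoʳ-≤ 2 longCount≤) ⟩
      10 * edgeCount G + 2 * (r * (r ∸ 1))      ≡⟨ cong (_+ 2 * (r * (r ∸ 1))) (*-assoc 2 5 (edgeCount G)) ⟩
      2 * (5 * edgeCount G) + 2 * (r * (r ∸ 1)) ≡⟨ *-distribˡ-+ 2 (5 * edgeCount G) (r * (r ∸ 1)) ⟨
      2 * (5 * edgeCount G + r * (r ∸ 1))       ∎)
      where open ≤-Reasoning

-- Breadth-first layers

least : {P : ℕ → Set} → Decidable P → ∀ k → P k → ∃ λ m → P m × (∀ {j} → P j → m ≤ j)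
least P? k pk with P? 0
... | yes p0 = 0 , p0 , λ _ → z≤n
least P? zero    pk | no ¬p0 = contradiction pk ¬p0
least {P} P? (suc k) pk | no ¬p0 with least (P? ∘ suc) k pk
... | m , pm , min = suc m , pm , λ { {zero} p0 → contradiction p0 ¬p0 ; {suc j} pj → s≤s (min pj) }

-- A breadth-first tree rooted at `v`, with `depth` as the distance to the root. The conditions on
-- `parent` apply away from the root only, hence the guard `x ≢ v` in `Tree`.
record Layering {n} (G : Graph n) (v : Fin n) : Set where
  field
    depth        : Fin n → ℕ
    parent       : Fin n → Fin n
    depth-root   : depth v ≡ 0
    depth-adj    : ∀ {x y} → Adj G x y → depth x ≤ suc (depth y)
    parent-adj   : ∀ {x} → x ≢ v → Adj G x (parent x)
    depth-parent : ∀ {x} → x ≢ v → depth x ≡ suc (depth (parent x))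

  depth≡0⇒root : ∀ {x} → depth x ≡ 0 → x ≡ v
  depth≡0⇒root {x} d with x Fin.≟ v
  ... | yes e = e
  ... | no x≢v = contradiction (trans (≡.sym (depth-parent x≢v)) d) λ ()

  depth≡suc⇒≢root : ∀ {x k} → depth x ≡ suc k → x ≢ v
  depth≡suc⇒≢root d refl = contradiction (trans (≡.sym d) depth-root) λ ()

  depth-path : ∀ {x} m → IsPath G x v m → depth x ≤ suc (length m)
  depth-path []      p = ≤-trans (depth-adj (path-headOr G [] p)) (s≤s (≤-reflexive depth-root))
  depth-path (y ∷ m) p =
    ≤-trans (depth-adj (path-headOr G (y ∷ m) p)) (s≤s (depth-path m (path-tail G m p)))

  depth-headOr : ∀ {x} m → IsPath G x v m → depth (headOr v m) ≤ length m
  depth-headOr []      p = ≤-reflexive depth-root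
  depth-headOr (y ∷ m) p = depth-path m (path-tail G m p)

module _ {n} (G : Graph n) (v : Fin n) (connected : ∀ x → x ≢ v → ∃ λ m → IsPath G x v m) where

  -- Walks of exactly the given length, with repeated vertices allowed: this makes the relation
  -- decidable by recursion on the length, and the least length is still the distance.
  Reach : ℕ → Fin n → Set
  Reach zero    x = x ≡ v
  Reach (suc k) x = ∃ λ y → Adj G x y × Reach k y

  Reach? : ∀ x → Decidable (λ k → Reach k x)
  Reach? x zero    = x Fin.≟ v
  Reach? x (suc k) = any? λ y → adj? G x y ×-dec Reach? y k

  path⇒Reach : ∀ {x} m → IsPath G x v m → Reach (suc (length m)) x
  path⇒Reach []      p = v , path-headOr G [] p , refl
  path⇒Reach (y ∷ m) p = y , path-headOr G (y ∷ m) p , path⇒Reach m (path-tail G m p)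

  reachable : ∀ x → ∃ λ k → Reach k x
  reachable x with x Fin.≟ v
  ... | yes e = 0 , e
  ... | no x≢v with connected x x≢v
  ...   | m , p = suc (length m) , path⇒Reach m p

  nearest : ∀ x → ∃ λ d → Reach d x × (∀ {j} → Reach j x → d ≤ j)
  nearest x = least (Reach? x) (proj₁ (reachable x)) (proj₂ (reachable x))

  -- The parent is the first step of a chosen shortest walk. The length is a separate argument so
  -- that the walk can be matched on.
  toParent : ∀ x k → Reach k x → Fin n
  toParent x zero    _       = x
  toParent x (suc k) (y , _) = y

  layering : Layering G v
  layering = record
    { depth        = depth
    ; parent       = λ x → toParent x (depth x) (reaches x)
    ; depth-root   = n≤0⇒n≡0 (shortest v refl)
    ; depth-adj    = λ {x} {y} xy → shortest x (y , xy , reaches y)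
    ; parent-adj   = λ {x} x≢v → adjacent x (depth x) (reaches x) x≢v
    ; depth-parent = λ {x} x≢v → descend x (depth x) (reaches x) (shortest x) x≢v
    }
    where
    depth : Fin n → ℕ
    depth x = proj₁ (nearest x)
    reaches : ∀ x → Reach (depth x) x
    reaches x = proj₁ (proj₂ (nearest x))
    shortest : ∀ x {j} → Reach j x → depth x ≤ j
    shortest x = proj₂ (proj₂ (nearest x))
    adjacent : ∀ x k (w : Reach k x) → x ≢ v → Adj G x (toParent x k w)
    adjacent x zero    w            x≢v = contradiction w x≢v
    adjacent x (suc k) (y , xy , _) _   = xy
    -- Going to the parent and then along its shortest walk gives one inequality; the remainder of
    -- the chosen walk, which starts at the parent, gives the other.
    descend : ∀ x k (w : Reach k x) → (∀ {j} → Reach j x → k ≤ j) → x ≢ v →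
              k ≡ suc (depth (toParent x k w))
    descend x zero    w            _   x≢v = contradiction w x≢v
    descend x (suc k) (y , xy , w) min _   =
      ≤-antisym (min (y , xy , reaches y)) (s≤s (shortest y w))

-- Non-tree edges

module ExtraEdges {n} (G : Graph n) (v : Fin n) (L : Layering G v) where
  open Layering L

  Tree : Fin n → Fin n → Set
  Tree x y = x ≢ v × parent x ≡ y

  Tree? : ∀ x y → Dec (Tree x y)
  Tree? x y = ¬? (x Fin.≟ v) ×-dec (parent x Fin.≟ y)

  Extra : Fin n → Fin n → Set
  Extra x y = Adj G x y × ¬ Tree x y × ¬ Tree y x

  Extra? : ∀ x y → Dec (Extra x y)
  Extra? x y = adj? G x y ×-dec ¬? (Tree? x y) ×-dec ¬? (Tree? y x)

  Extra-sym : ∀ {x y} → Extra x y → Extra y x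
  Extra-sym (xy , ¬t , ¬t′) = Adj-sym G xy , ¬t′ , ¬t

  Tree⇒depth : ∀ {x y} → Tree x y → depth x ≡ suc (depth y)
  Tree⇒depth (x≢v , refl) = depth-parent x≢v

  -- Children of `x` lie one layer deeper than `x`, so `y` is not a child, and by hypothesis it is
  -- not the parent.
  low-nbr⇒Extra : ∀ {x y k} → depth x ≡ k → Adj G x y → depth y ≤ k → y ≢ parent x → Extra x y
  low-nbr⇒Extra dx xy dy y≢p =
    xy , (λ t → y≢p (≡.sym (proj₂ t))) ,
    λ t → 1+n≰n (≤-trans (≤-reflexive (trans (cong suc (≡.sym dx)) (≡.sym (Tree⇒depth t)))) dy)

  -- The vertex that a non-tree edge serves besides its two ends: the parent of the strictly deeper
  -- end. Equal depths fall to `parent t`.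
  third : Fin n → Fin n → Fin n
  third s t with depth t <? depth s
  ... | yes _ = parent s
  ... | no _  = parent t

  -- A sum rather than a disjunction, so that coinciding vertices count with multiplicity and the
  -- total over all `x` is exactly 3.
  Serves : Fin n → Fin n → Fin n → ℕ
  Serves s t x = ⟦ x Fin.≟ s ⟧ + ⟦ x Fin.≟ t ⟧ + ⟦ x Fin.≟ third s t ⟧

  Served : Fin n → Set
  Served x = ∃₂ λ s t → Extra s t × (x ≡ s ⊎ (x ≡ parent s × depth t < depth s))

  -- Non-tree edges are counted in both orientations. The strict inequality determines the deeper
  -- end, so `third` is the same vertex for both.
  served-both : ∀ {x s t} → x ≡ s ⊎ (x ≡ parent s × depth t < depth s) →
                1 ≤ Serves s t x × 1 ≤ Serves t s x
  served-both {x} {s} {t} (inj₁ x≡s) =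
    three-δ-cover s t (third s t) (inj₁ x≡s) , three-δ-cover t s (third t s) (inj₂ (inj₁ x≡s))
  served-both {x} {s} {t} (inj₂ (x≡p , t<s)) =
    three-δ-cover s t (third s t) (inj₂ (inj₂ (trans x≡p st))) ,
    three-δ-cover t s (third t s) (inj₂ (inj₂ (trans x≡p ts)))
    where
    st : parent s ≡ third s t
    st with depth t <? depth s
    ... | yes _ = refl
    ... | no ¬< = contradiction t<s ¬<
    ts : parent s ≡ third t s
    ts with depth s <? depth t
    ... | yes s<t = contradiction s<t (<-asym t<s)
    ... | no _    = refl

  -- Each non-tree edge is counted twice here, once per orientation, whereas `treeCount` counts a
  -- tree edge once, from child to parent.
  extraCount : ℕ
  extraCount = ∑[ s < n ] ∑[ t < n ] ⟦ Extra? s t ⟧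

  deepCount : ℕ
  deepCount = ∑[ x < n ] ⟦ 2 ℕ.≤? depth x ⟧

  treeCount : ℕ
  treeCount = ∑[ x < n ] ∑[ y < n ] ⟦ Tree? x y ⟧

  -- Double counting of incidences: a deep vertex is served by both orientations of some non-tree
  -- edge, and each orientation serves three vertices with multiplicity.
  2deep≤3extra : (∀ x → 2 ≤ depth x → Served x) → 2 * deepCount ≤ 3 * extraCount
  2deep≤3extra served = begin
    2 * deepCount                                                  ≡⟨ ∑-scale 2 (λ x → ⟦ 2 ℕ.≤? depth x ⟧) ⟨
    ∑[ x < n ] (2 * ⟦ 2 ℕ.≤? depth x ⟧)                            ≤⟨ ∑-mono served-twice ⟩
    ∑[ x < n ] ∑[ s < n ] ∑[ t < n ] (⟦ Extra? s t ⟧ * Serves s t x) ≡⟨ ∑-comm (λ x s → ∑[ t < n ] (⟦ Extra? s t ⟧ * Serves s t x)) ⟩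
    ∑[ s < n ] ∑[ x < n ] ∑[ t < n ] (⟦ Extra? s t ⟧ * Serves s t x) ≡⟨ sum-cong-≗ (λ s → ∑-comm (λ x t → ⟦ Extra? s t ⟧ * Serves s t x)) ⟩
    ∑[ s < n ] ∑[ t < n ] ∑[ x < n ] (⟦ Extra? s t ⟧ * Serves s t x) ≡⟨ sum-cong-≗ (λ s → sum-cong-≗ λ t → per-edge s t) ⟩
    ∑[ s < n ] ∑[ t < n ] (3 * ⟦ Extra? s t ⟧)                     ≡⟨ sum-cong-≗ (λ s → ∑-scale 3 (λ t → ⟦ Extra? s t ⟧)) ⟩
    ∑[ s < n ] (3 * (∑[ t < n ] ⟦ Extra? s t ⟧))                   ≡⟨ ∑-scale 3 (λ s → ∑[ t < n ] ⟦ Extra? s t ⟧) ⟩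
    3 * extraCount                                                 ∎
    where
    open ≤-Reasoning
    served-twice : ∀ x → 2 * ⟦ 2 ℕ.≤? depth x ⟧ ≤ ∑[ s < n ] ∑[ t < n ] (⟦ Extra? s t ⟧ * Serves s t x)
    served-twice x = scaled-⟦⟧-≤ (2 ℕ.≤? depth x) 2 twice
      where
      twice : 2 ≤ depth x → _
      twice dx with served x dx
      ... | s , t , e , h = ∑∑-swapped-pair (λ s t → ⟦ Extra? s t ⟧ * Serves s t x)
        (Adj⇒≢ G (proj₁ e))
        (*-mono-≤ (⟦⟧-yes (Extra? s t) e) (proj₁ (served-both h)))
        (*-mono-≤ (⟦⟧-yes (Extra? t s) (Extra-sym e)) (proj₂ (served-both {t = t} h)))
    per-edge : ∀ s t → ∑[ x < n ] (⟦ Extra? s t ⟧ * Serves s t x) ≡ 3 * ⟦ Extra? s t ⟧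
    per-edge s t = trans (∑-scale ⟦ Extra? s t ⟧ (Serves s t))
      (trans (cong (⟦ Extra? s t ⟧ *_) (∑-three-δ s t (third s t))) (*-comm ⟦ Extra? s t ⟧ 3))

  -- For a given ordered pair, being child and parent, parent and child, or a non-tree edge are
  -- mutually exclusive, and each implies adjacency.
  2tree+extra≤2e : 2 * treeCount + extraCount ≤ 2 * edgeCount G
  2tree+extra≤2e = begin
    2 * treeCount + extraCount                 ≡⟨ cong (_+ extraCount) (cong (treeCount +_) (+-identityʳ treeCount)) ⟩
    treeCount + treeCount + extraCount         ≡⟨ cong (λ k → treeCount + k + extraCount) (∑-comm (λ x y → ⟦ Tree? x y ⟧)) ⟩
    treeCount + (∑[ x < n ] ∑[ y < n ] ⟦ Tree? y x ⟧) + extraCount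
      ≡⟨ cong (_+ extraCount) (∑-distrib-+ (λ x → ∑[ y < n ] ⟦ Tree? x y ⟧) (λ x → ∑[ y < n ] ⟦ Tree? y x ⟧)) ⟨
    (∑[ x < n ] (row x + column x)) + extraCount
      ≡⟨ ∑-distrib-+ (λ x → row x + column x) (λ x → ∑[ y < n ] ⟦ Extra? x y ⟧) ⟨
    ∑[ x < n ] (row x + column x + (∑[ y < n ] ⟦ Extra? x y ⟧))  ≤⟨ ∑-mono per-vertex ⟩
    ∑[ x < n ] deg G x                         ≡⟨ handshake G ⟩
    2 * edgeCount G                            ∎
    where
    open ≤-Reasoning
    row column : Fin n → ℕ
    row x    = ∑[ y < n ] ⟦ Tree? x y ⟧
    column x = ∑[ y < n ] ⟦ Tree? y x ⟧
    per-pair : ∀ x y → ⟦ Tree? x y ⟧ + ⟦ Tree? y x ⟧ + ⟦ Extra? x y ⟧ ≤ ⟦ adj? G x y ⟧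
    per-pair x y = cases (Tree? x y) (Tree? y x) (Extra? x y)
      where
      cases : (a : Dec (Tree x y)) (b : Dec (Tree y x)) (e : Dec (Extra x y)) →
              ⟦ a ⟧ + ⟦ b ⟧ + ⟦ e ⟧ ≤ ⟦ adj? G x y ⟧
      -- Two vertices that are parents of each other would each be one layer deeper than the other.
      cases (yes t) (yes t′) _ = contradiction
        (≤-reflexive (trans (cong suc (≡.sym (Tree⇒depth t))) (≡.sym (Tree⇒depth t′))))
        λ h → 1+n≰n (<⇒≤ h)
      cases (yes t) (no _)   (yes (_ , ¬t , _)) = contradiction t ¬t
      cases (yes (x≢v , refl)) (no _) (no _) = ⟦⟧-yes (adj? G x _) (parent-adj x≢v)
      cases (no _)  (yes t)  (yes (_ , _ , ¬t)) = contradiction t ¬t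
      cases (no _)  (yes (y≢v , refl)) (no _) = ⟦⟧-yes (adj? G _ y) (Adj-sym G (parent-adj y≢v))
      cases (no _)  (no _)   (yes (xy , _)) = ⟦⟧-yes (adj? G x y) xy
      cases (no _)  (no _)   (no _)  = z≤n
    per-vertex : ∀ x → row x + column x + (∑[ y < n ] ⟦ Extra? x y ⟧) ≤ deg G x
    per-vertex x = begin
      row x + column x + (∑[ y < n ] ⟦ Extra? x y ⟧)
        ≡⟨ cong (_+ (∑[ y < n ] ⟦ Extra? x y ⟧)) (∑-distrib-+ (λ y → ⟦ Tree? x y ⟧) (λ y → ⟦ Tree? y x ⟧)) ⟨
      (∑[ y < n ] (⟦ Tree? x y ⟧ + ⟦ Tree? y x ⟧)) + (∑[ y < n ] ⟦ Extra? x y ⟧)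
        ≡⟨ ∑-distrib-+ (λ y → ⟦ Tree? x y ⟧ + ⟦ Tree? y x ⟧) (λ y → ⟦ Extra? x y ⟧) ⟨
      ∑[ y < n ] (⟦ Tree? x y ⟧ + ⟦ Tree? y x ⟧ + ⟦ Extra? x y ⟧)  ≤⟨ ∑-mono (per-pair x) ⟩
      deg G x ∎

  n≤tree+1 : n ≤ treeCount + 1
  n≤tree+1 = begin
    n                                      ≡⟨ *-identityʳ n ⟨
    n * 1                                  ≡⟨ ∑-const n 1 ⟨
    ∑[ x < n ] 1                           ≤⟨ ∑-mono covered ⟩
    ∑[ x < n ] ((∑[ y < n ] ⟦ Tree? x y ⟧) + ⟦ x Fin.≟ v ⟧)
                                           ≡⟨ ∑-distrib-+ (λ x → ∑[ y < n ] ⟦ Tree? x y ⟧) (λ x → ⟦ x Fin.≟ v ⟧) ⟩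
    treeCount + ∑[ x < n ] ⟦ x Fin.≟ v ⟧   ≡⟨ cong (treeCount +_) (∑-δ v) ⟩
    treeCount + 1                          ∎
    where
    open ≤-Reasoning
    covered : ∀ x → 1 ≤ (∑[ y < n ] ⟦ Tree? x y ⟧) + ⟦ x Fin.≟ v ⟧
    covered x = by (x Fin.≟ v)
      where
      by : (d : Dec (x ≡ v)) → 1 ≤ (∑[ y < n ] ⟦ Tree? x y ⟧) + ⟦ d ⟧
      by (yes _)  = m≤n+m 1 _
      by (no x≢v) = ≤-trans
        (≤-trans (⟦⟧-yes (Tree? x (parent x)) (x≢v , refl)) (term≤∑ (λ y → ⟦ Tree? x y ⟧) (parent x)))
        (m≤m+n _ _)

  -- A vertex at depth one has the root as its parent, so only the root and its two neighbours have
  -- depth at most one.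
  n≤deep+3 : ∀ {a b} → deg G v ≡ 2 → Adj G v a → Adj G v b → a ≢ b → n ≤ deepCount + 3
  n≤deep+3 {a} {b} dv va vb a≢b = begin
    n                                      ≡⟨ *-identityʳ n ⟨
    n * 1                                  ≡⟨ ∑-const n 1 ⟨
    ∑[ x < n ] 1                           ≤⟨ ∑-mono covered ⟩
    ∑[ x < n ] (⟦ 2 ℕ.≤? depth x ⟧ + near x) ≡⟨ ∑-distrib-+ (λ x → ⟦ 2 ℕ.≤? depth x ⟧) near ⟩
    deepCount + sum near                   ≡⟨ cong (deepCount +_) (∑-three-δ v a b) ⟩
    deepCount + 3                          ∎
    where
    open ≤-Reasoning
    near : Fin n → ℕ
    near x = ⟦ x Fin.≟ v ⟧ + ⟦ x Fin.≟ a ⟧ + ⟦ x Fin.≟ b ⟧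
    by : ∀ x → 2 ≤ depth x ⊎ x ≡ v ⊎ x ≡ a ⊎ x ≡ b → 1 ≤ ⟦ 2 ℕ.≤? depth x ⟧ + near x
    by x (inj₁ h) = ≤-trans (⟦⟧-yes (2 ℕ.≤? depth x) h) (m≤m+n _ _)
    by x (inj₂ h) = ≤-trans (three-δ-cover v a b h) (m≤n+m (near x) ⟦ 2 ℕ.≤? depth x ⟧)
    covered : ∀ x → 1 ≤ ⟦ 2 ℕ.≤? depth x ⟧ + near x
    covered x = by x (classify (depth x) refl)
      where
      classify : ∀ k → depth x ≡ k → 2 ≤ depth x ⊎ x ≡ v ⊎ x ≡ a ⊎ x ≡ b
      classify zero          d = inj₂ (inj₁ (depth≡0⇒root d))
      classify (suc (suc k)) d = inj₁ (≤-trans (s≤s (s≤s z≤n)) (≤-reflexive (≡.sym d)))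
      classify (suc zero)    d = inj₂ (inj₂ (degree-two-nbr G dv va vb a≢b (Adj-sym G xv)))
        where
        x≢v : x ≢ v
        x≢v = depth≡suc⇒≢root d
        xv : Adj G x v
        xv = subst (Adj G x) (depth≡0⇒root (suc-injective (trans (≡.sym (depth-parent x≢v)) d)))
               (parent-adj x≢v)

  4n≤3e+6 : ∀ {a b} → deg G v ≡ 2 → Adj G v a → Adj G v b → a ≢ b →
            (∀ x → 2 ≤ depth x → Served x) → 4 * n ≤ 3 * edgeCount G + 6
  4n≤3e+6 dv va vb a≢b served = *-cancelˡ-≤ 2 (begin
    2 * (4 * n)                                   ≡⟨ regroup₁ n ⟩
    -- Of the 8n, the tree bounds 6n and the deep vertices bound 2n. With these weights the served
    -- count turns the right side into three times the left side of `2tree+extra≤2e`, plus 12.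
    6 * n + 2 * n                                 ≤⟨ +-mono-≤ (*-monoʳ-≤ 6 n≤tree+1) (*-monoʳ-≤ 2 (n≤deep+3 dv va vb a≢b)) ⟩
    6 * (treeCount + 1) + 2 * (deepCount + 3)     ≡⟨ regroup₂ treeCount deepCount ⟩
    6 * treeCount + 2 * deepCount + 12            ≤⟨ +-monoˡ-≤ 12 (+-monoʳ-≤ (6 * treeCount) (2deep≤3extra served)) ⟩
    6 * treeCount + 3 * extraCount + 12           ≡⟨ regroup₃ treeCount extraCount ⟩
    3 * (2 * treeCount + extraCount) + 12         ≤⟨ +-monoˡ-≤ 12 (*-monoʳ-≤ 3 2tree+extra≤2e) ⟩
    3 * (2 * edgeCount G) + 12                    ≡⟨ regroup₄ (edgeCount G) ⟩
    2 * (3 * edgeCount G + 6)                     ∎)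
    where
    open ≤-Reasoning
    regroup₁ : ∀ n → 2 * (4 * n) ≡ 6 * n + 2 * n
    regroup₁ = solve-∀
    regroup₂ : ∀ t d → 6 * (t + 1) + 2 * (d + 3) ≡ 6 * t + 2 * d + 12
    regroup₂ = solve-∀
    regroup₃ : ∀ t x → 6 * t + 3 * x + 12 ≡ 3 * (2 * t + x) + 12
    regroup₃ = solve-∀
    regroup₄ : ∀ e → 3 * (2 * e) + 12 ≡ 2 * (3 * e + 6)
    regroup₄ = solve-∀

-- Serving by short rainbow paths

module _ {n r : ℕ} (G : Graph n) (c : Colouring G r) (rtc : RainbowTwoConnected c) (r≤4 : r ≤ 4)
         (v : Fin n) (L : Layering G v) where

  open RainbowTwoConnectedGraph G c rtc
  open DecMembership (Fin._≟_ {n}) using (_∈?_)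

  -- A path has one edge more than inner vertices, and a rainbow path has at most r ≤ 4 edges.
  rainbow⇒short : ∀ {x} m → Rainbow c x v m → length m ≤ 3
  rainbow⇒short {x} m rb = s≤s⁻¹ (≤-trans
    (≤-reflexive (≡.sym (trans (length-map _ (edgesOf (x ∷ (m ∷ʳ v)))) (length-edgesOf x v m))))
    (≤-trans (Unique⇒length≤ rb) r≤4))

  open Layering L
  open ExtraEdges G v L

  depth≤4 : ∀ x → depth x ≤ 4
  depth≤4 x with x Fin.≟ v
  ... | yes refl = ≤-trans (≤-reflexive depth-root) z≤n
  ... | no x≢v with rtc x v x≢v
  ...   | m , _ , p , _ , rb , _ = ≤-trans (depth-path m p) (s≤s (rainbow⇒short m rb))

  -- Both rainbow paths to the root have at most four edges, so their second vertices have depth at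
  -- most 3. These vertices differ, so one of them is not the parent. The strict drop in depth lets
  -- the edge also serve the parent of `x`.
  extra-at-depth-4 : ∀ {x} → depth x ≡ 4 → ∃ λ s → Extra x s × depth s < depth x
  extra-at-depth-4 {x} dx with rtc x v (depth≡suc⇒≢root dx)
  ... | m₁ , m₂ , p₁ , p₂ , rb₁ , rb₂ , d = pick (headOr v m₁ Fin.≟ parent x)
    where
    via : ∀ m → IsPath G x v m → Rainbow c x v m → headOr v m ≢ parent x →
          ∃ λ s → Extra x s × depth s < depth x
    via m p rb h≢p = headOr v m , low-nbr⇒Extra dx (path-headOr G m p) (≤-trans low (n≤1+n 3)) h≢p ,
                     ≤-trans (s≤s low) (≤-reflexive (≡.sym dx))
      where
      low : depth (headOr v m) ≤ 3
      low = ≤-trans (depth-headOr m p) (rainbow⇒short m rb)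
    pick : Dec (headOr v m₁ ≡ parent x) → ∃ λ s → Extra x s × depth s < depth x
    pick (no h≢p)  = via m₁ p₁ rb₁ h≢p
    pick (yes h≡p) = via m₂ p₂ rb₂ λ e → disjoint-headOr G p₁ p₂ d (trans h≡p (≡.sym e))

  -- A child of `x` has depth 4, and its non-tree edge serves `x` as the parent of its deeper end.
  -- Without children, every edge at `x` except the one to its parent is a non-tree edge, and `x`
  -- has at least two neighbours.
  served-at-depth-3 : ∀ {x} → depth x ≡ 3 → Served x
  served-at-depth-3 {x} dx with any? (λ w → Tree? w x)
  ... | yes (w , t) with extra-at-depth-4 (trans (Tree⇒depth t) (cong suc dx))
  ...   | s , e , s<w = w , s , e , inj₂ (≡.sym (proj₂ t) , s<w)
  served-at-depth-3 {x} dx | no ¬child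
    with two-neighbours (depth≡suc⇒≢root dx)
  ... | a , b , a≢b , xa , xb with a Fin.≟ parent x
  ...   | no a≢p = x , a , (xa , (λ t → a≢p (≡.sym (proj₂ t))) , λ t → ¬child (a , t)) , inj₁ refl
  ...   | yes a≡p = x , b , (xb , (λ t → a≢b (trans a≡p (proj₂ t))) , λ t → ¬child (b , t)) , inj₁ refl

  -- If the first step y of the path is a child of x, then the next edge of the path is extra
  -- and serves x as the parent of y.
  served-by-path-avoiding-parent : ∀ {x} → depth x ≡ 2 → ∀ m → IsPath G x v m → length m ≤ 3 →
                                   parent x ∉ m → Served x
  served-by-path-avoiding-parent dx [] p _ _ =
    contradiction (≤-trans (≤-reflexive (≡.sym dx)) (depth-path [] p)) λ { (s≤s ()) }
  served-by-path-avoiding-parent {x} dx (y ∷ m) p len p∉ with Tree? y x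
  ... | no ¬t = x , y , (path-headOr G (y ∷ m) p , (λ t → p∉ (here (proj₂ t))) , ¬t) , inj₁ refl
  ... | yes t = y , z , low-nbr⇒Extra dy yz (≤-trans dz (n≤1+n 2)) z≢parent ,
                inj₂ (≡.sym (proj₂ t) , ≤-trans (s≤s dz) (≤-reflexive (≡.sym dy)))
    where
    z = headOr v m
    dy : depth y ≡ 3
    dy = trans (Tree⇒depth t) (cong suc dx)
    yz : Adj G y z
    yz = path-headOr G m (path-tail G m p)
    dz : depth z ≤ 2
    dz = ≤-trans (depth-headOr m (path-tail G m p)) (s≤s⁻¹ len)
    z≢parent : z ≢ parent y
    z≢parent e = path-∉ G (y ∷ m) p (there (headOr∈ G m)) (trans e (proj₂ t))

  -- The parent can be an inner vertex of only one of the two disjoint paths; the other path avoids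
  -- it.
  served-at-depth-2 : ∀ {x} → depth x ≡ 2 → Served x
  served-at-depth-2 {x} dx with rtc x v (depth≡suc⇒≢root dx)
  ... | m₁ , m₂ , p₁ , p₂ , rb₁ , rb₂ , _ , disjoint with parent x ∈? m₁
  ...   | no ∉₁  = served-by-path-avoiding-parent dx m₁ p₁ (rainbow⇒short m₁ rb₁) ∉₁
  ...   | yes ∈₁ = served-by-path-avoiding-parent dx m₂ p₂ (rainbow⇒short m₂ rb₂) (disjoint _ ∈₁)

  served : ∀ x → 2 ≤ depth x → Served x
  served x = by (depth x) refl (depth≤4 x)
    where
    by : ∀ k → depth x ≡ k → k ≤ 4 → 2 ≤ k → Served x
    by 2 dx _ _ = served-at-depth-2 dx
    by 3 dx _ _ = served-at-depth-3 dx
    by 4 dx _ _ with extra-at-depth-4 dx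
    ... | s , e , _ = x , s , e , inj₁ refl
    by 0 _ _ ()
    by 1 _ _ (s≤s ())
    by (suc (suc (suc (suc (suc _))))) _ (s≤s (s≤s (s≤s (s≤s ())))) _

  degree-two⇒4n≤3e+6 : deg G v ≡ 2 → ∃ (v ≢_) → 4 * n ≤ 3 * edgeCount G + 6
  degree-two⇒4n≤3e+6 dv (_ , v≢w) with two-neighbours v≢w
  ... | a , b , a≢b , va , vb = 4n≤3e+6 dv va vb a≢b served

-- Assembling the two bounds

another-vertex : ∀ {n} → 3 ≤ n → (u : Fin n) → ∃ (u ≢_)
another-vertex (s≤s (s≤s _)) zero    = suc zero , λ ()
another-vertex (s≤s (s≤s _)) (suc u) = zero , λ ()

4n≤3e+72 : ∀ {n r} → r ≤ 4 → t₂-lower n r (λ e → 4 * n ≤ 3 * e + 72)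
4n≤3e+72 {n} r≤4 G (3≤n , _) (c , rtc) with any? (λ v → deg G v ℕ.≟ 2)
... | yes (v , dv) = ≤-trans
  (degree-two⇒4n≤3e+6 G c rtc r≤4 v (layering G v connected) dv (another-vertex 3≤n v))
  -- The tree argument gives the constant 6; the stated 72 is 3 · 24.
  (+-monoʳ-≤ (3 * edgeCount G) (m≤m+n 6 66))
  where
  connected : ∀ x → x ≢ v → ∃ λ m → IsPath G x v m
  connected x x≢v = let m , _ , p , _ = rtc x v x≢v in m , p
-- All degrees are at least three, so 9n ≤ 6e, and 8n ≤ 9n.
... | no ¬deg2 = ≤-trans (*-cancelˡ-≤ 2 (begin
    2 * (4 * n)              ≤⟨ m≤m+n _ n ⟩
    2 * (4 * n) + n          ≡⟨ regroup n ⟩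
    3 * (n * 3)              ≤⟨ *-monoʳ-≤ 3 (min-degree-three⇒3n≤2e G 3≤deg) ⟩
    3 * (2 * edgeCount G)    ≡⟨ regroup′ (edgeCount G) ⟩
    2 * (3 * edgeCount G)    ∎)) (m≤m+n _ 72)
  where
  open ≤-Reasoning
  open RainbowTwoConnectedGraph G c rtc using (2≤deg)
  3≤deg : ∀ x → 3 ≤ deg G x
  3≤deg x = ≤∧≢⇒< (2≤deg (another-vertex 3≤n) x) λ d → ¬deg2 (x , ≡.sym d)
  regroup : ∀ n → 2 * (4 * n) + n ≡ 3 * (n * 3)
  regroup = solve-∀
  regroup′ : ∀ e → 3 * (2 * e) ≡ 2 * (3 * e)
  regroup′ = solve-∀

theorem3p1 : (∀ (n r : ℕ) → (r ≡ 3 ⊎ r ≡ 4) → 18 ≤ n →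
    t₂-lower n r (λ e → 4 * n ≤ 3 * e + 72))
    × (∀ (n r : ℕ) → 5 ≤ r → r ≤ n ∸ 1 → r * (r ∸ 1) < 6 * n →
    t₂-lower n r (λ e → 6 * n ≤ 5 * e + r * (r ∸ 1)))
theorem3p1 = part-i , part-ii
  where
  part-i : ∀ (n r : ℕ) → (r ≡ 3 ⊎ r ≡ 4) → 18 ≤ n → t₂-lower n r (λ e → 4 * n ≤ 3 * e + 72)
  part-i n _ (inj₁ refl) _ = 4n≤3e+72 (n≤1+n 3)
  part-i n _ (inj₂ refl) _ = 4n≤3e+72 ≤-refl
  part-ii : ∀ (n r : ℕ) → 5 ≤ r → r ≤ n ∸ 1 → r * (r ∸ 1) < 6 * n →
            t₂-lower n r (λ e → 6 * n ≤ 5 * e + r * (r ∸ 1))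
  part-ii n r _ _ _ G (3≤n , _) (c , rtc) =
    RainbowTwoConnectedGraph.6n≤5e+r[r-1] G c rtc (another-vertex 3≤n)
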